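{- AC is a decision procedure for $\mathrm{CSP}_{\overline{SP}}(\mathrm{BTX})$.
   Context: Patterns. A pattern is a tuple $\langle X,D,A,\mathrm{cpt},<_X,<_D\rangle$ where $X$ is a finite set of variables; $D$ is a finite set of values; $A\subseteq X\times D$ is the set of points, with $D(x)=\{a\in D\mid \langle x,a\rangle\in A\}$ non-empty for every $x\in X$; $\mathrm{cpt}$ is a partial function from the set of unordered pairs of points $\{\langle x,a\rangle,\langle y,b\rangle\}$ with $x\neq y$ to $\{\mathrm{TRUE},\mathrm{FALSE}\}$; $<_X$ and $<_D$ are (possibly partial, possibly empty) strict orders on $X$ and $D$. Pairs of points with $\mathrm{cpt}=\mathrm{TRUE}$ (FALSE) are called positive (negative) edges. Instances. A (binary CSP) instance is a pattern $\langle X,D,A,\mathrm{cpt}\rangle$ without orders, with $\mathrm{cpt}$ total on all unordered pairs of points belonging to distinct variables. $R_{x,y}=\{\langle a,b\rangle\in D(x)\times D(y)\mid \mathrm{cpt}(\langle x,a\rangle,\langle y,b\rangle)=\mathrm{TRUE}\}$. A solution is a map $s:X\to D$ with $s(x)\in D(x)$ and $\langle s(x),s(y)\rangle\in R_{x,y}$ for all $x\neq y$. Occurrence. A homomorphism from $P'=\langle X',D',A',\mathrm{cpt}',<_{X'},<_{D'}\rangle$ to $P=\langle X,D,A,\mathrm{cpt},<_X,<_D\rangle$ is a (not necessarily injective) map $f:A'\to A$ such that: if $\mathrm{cpt}'(p,q)$ is defined then $\mathrm{cpt}(f(p),f(q))=\mathrm{cpt}'(p,q)$; the map $f_{var}:X'\to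 X$ given by $f_{var}(x')=x$ if $f(\langle x',a'\rangle)=\langle x,a\rangle$ for some $a',a$ is well-defined and injective; $x'<_{X'}y'$ implies $f_{var}(x')<_X f_{var}(y')$; and if $a',b'\in D'(x')$, $a'<_{D'}b'$, $f(\langle x',a'\rangle)=\langle x,a\rangle$, $f(\langle x',b'\rangle)=\langle x,b\rangle$, then $a<_D b$. A pattern $P$ occurs in an instance $I$ if for every pair of total orders on the variables and on the values of $I$ there is a homomorphism from $P$ to $I$ equipped with these orders. $\mathrm{CSP}_{\overline{SP}}(P)$ is the set of instances in which $P$ does not occur (i.e. instances for which there exist total orders on the variables and on the values such that $P$ has no homomorphism to the instance equipped with them). Arc consistency. A point $\langle x,a\rangle$ of an instance is arc consistent if for every variable $y\neq x$ there is a point $\langle y,b\rangle$ compatible with it ($\mathrm{cpt}=\mathrm{TRUE}$). Establishing arc consistency means repeatedly removing points that are not arc consistent. AC is a decision procedure for a class of instances if for every instance of the class, non-emptiness of all domains after establishing arc consistency guarantees that the instance has a solution. The pattern $\mathrm{BTX}$: variables $x,y,z$ with pairwise disjoint domains $D(x)=\{\epsilon\}$, $D(y)=\{\alpha,\beta\}$, $D(z)=\{\gamma,\delta\}$ (each value stands for its point); negative edges $\alpha\gamma$, $\epsilon\delta$; positive edges $\alpha\delta$, $\beta\gamma$, $\alpha\epsilon$, $\epsilon\gamma$; no other pair of points has defined compatibility; variable order $y<x$, $y<z$; domain order $\alpha>\beta$. -}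

module Defs where

open import Data.Bool using (Bool; true; false)
import Data.Bool.Properties as Bool
open import Data.Fin using (Fin; zero; suc)
open import Data.Fin.Properties using (all?)
open import Data.Fin.Subset using (Subset; _∈_; Nonempty; ⁅_⁆; _∪_; _-_)
open import Data.Fin.Subset.Properties using (_∈?_)
open import Data.Maybe using (Maybe; just; nothing; Is-just)
import Data.Maybe.Properties as Maybe
open import Data.Nat using (ℕ)
open import Data.Product using (Σ-syntax; ∃-syntax; _×_; _,_)
open import Data.Vec.Functional using (updateAt)
open import Function.Definitions using (Injective)
open import Level using (0ℓ)
open import Relation.Binary.Core using (Rel)
open import Relation.Binary.Structures using (IsStrictPartialOrder; IsStrictTotalOrder)
open import Relation.Binary.PropositionalEquality
  using (_≡_; _≢_; refl; isEquivalence; resp₂)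
open import Relation.Binary.Construct.Closure.ReflexiveTransitive using (Star)
open import Relation.Nullary using (¬_)
open import Relation.Nullary.Decidable using (from-yes; recompute; _→-dec_)

------------------------------------------------------------------------
-- Patterns

-- The membership proof is irrelevant, so a point is determined
-- (definitionally) by its variable and its value.
record PointOf {n d : ℕ} (dom : Fin n → Subset d) : Set where
  constructor point
  field
    var  : Fin n
    val  : Fin d
    .mem : val ∈ dom var

open PointOf public

-- X = Fin #vars, D = Fin #vals, A = { ⟨x,a⟩ ∣ a ∈ dom x }.  The partial
-- function cpt on unordered pairs of points with distinct variables is a
-- symmetric Maybe-valued function, undefined (nothing) on all other pairs.
record UnorderedPattern : Set where
  field
    #vars #vals  : ℕ
    dom          : Fin #vars → Subset #vals
    dom-nonempty : ∀ x → Nonempty (dom x)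
    cpt          : PointOf dom → PointOf dom → Maybe Bool
    cpt-sym      : ∀ p q → cpt p q ≡ cpt q p
    cpt-same-var : ∀ p q → var p ≡ var q → cpt p q ≡ nothing

  Point : Set
  Point = PointOf dom

record Pattern : Set₁ where
  field
    unordered : UnorderedPattern
  open UnorderedPattern unordered public
  field
    _<X_      : Rel (Fin #vars) 0ℓ
    _<D_      : Rel (Fin #vals) 0ℓ
    <X-strict : IsStrictPartialOrder _≡_ _<X_
    <D-strict : IsStrictPartialOrder _≡_ _<D_

------------------------------------------------------------------------
-- Instances

record Instance : Set where
  field
    unordered : UnorderedPattern
  open UnorderedPattern unordered public
  field
    cpt-total : ∀ p q → var p ≢ var q → Is-just (cpt p q)

  R : (x y : Fin #vars) → Rel (Fin #vals) 0ℓ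
  R x y a b = Σ[ a∈ ∈ a ∈ dom x ] Σ[ b∈ ∈ b ∈ dom y ]
              cpt (point x a a∈) (point y b b∈) ≡ just true

record Solution (I : Instance) : Set where
  open Instance I
  field
    s          : Fin #vars → Fin #vals
    s∈dom      : ∀ x → s x ∈ dom x
    compatible : ∀ x y → x ≢ y → R x y (s x) (s y)

------------------------------------------------------------------------
-- Occurrence

record Homomorphism (P′ P : Pattern) : Set where
  private
    module P′ = Pattern P′
    module P  = Pattern P
  field
    f              : P′.Point → P.Point
    f-cpt          : ∀ p q b → P′.cpt p q ≡ just b → P.cpt (f p) (f q) ≡ just b
    -- f-var is determined by f, as every domain of P′ is non-empty.
    f-var          : Fin P′.#vars → Fin P.#vars
    f-var-def      : ∀ p → var (f p) ≡ f-var (var p)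
    f-var-injective : Injective _≡_ _≡_ f-var
    f-var-mono     : ∀ x y → x P′.<X y → f-var x P.<X f-var y
    f-val-mono     : ∀ p q → var p ≡ var q →
                     val p P′.<D val q → val (f p) P.<D val (f q)

module _ (I : Instance) where
  open Instance I

  equip : {_<X_ : Rel (Fin #vars) 0ℓ} {_<D_ : Rel (Fin #vals) 0ℓ} →
          IsStrictTotalOrder _≡_ _<X_ → IsStrictTotalOrder _≡_ _<D_ → Pattern
  equip {_<X_} {_<D_} <X-total <D-total = record
    { unordered = unordered
    ; _<X_      = _<X_
    ; _<D_      = _<D_
    ; <X-strict = IsStrictTotalOrder.isStrictPartialOrder <X-total
    ; <D-strict = IsStrictTotalOrder.isStrictPartialOrder <D-total
    }

_OccursIn_ : Pattern → Instance → Set₁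
P OccursIn I =
  (_<X_ : Rel (Fin #vars) 0ℓ) (<X-total : IsStrictTotalOrder _≡_ _<X_)
  (_<D_ : Rel (Fin #vals) 0ℓ) (<D-total : IsStrictTotalOrder _≡_ _<D_) →
  Homomorphism P (equip I <X-total <D-total)
  where open Instance I

CSP-SP : Pattern → Instance → Set₁
CSP-SP P I = ¬ (P OccursIn I)

------------------------------------------------------------------------
-- Arc consistency

-- A family E of current domains records which points of I have not been
-- removed so far; unlike dom, its members may become empty.
module ArcConsistency (I : Instance) where
  open Instance I

  Domains : Set
  Domains = Fin #vars → Subset #vals

  _Contains_ : Domains → Point → Set
  E Contains p = val p ∈ E (var p)

  ArcConsistent : Domains → Point → Set
  ArcConsistent E p = ∀ y → y ≢ var p →
    ∃[ q ] var q ≡ y × E Contains q × cpt p q ≡ just true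

  data _⟶_ (E : Domains) : Domains → Set where
    remove : ∀ p → E Contains p → ¬ ArcConsistent E p →
             E ⟶ updateAt E (var p) (_- val p)

  -- E results from dom by removing points until none can be removed.
  EstablishedBy : Domains → Set
  EstablishedBy E = Star _⟶_ dom E × (∀ p → E Contains p → ArcConsistent E p)

ACDecides : (Instance → Set₁) → Set₁
ACDecides C = ∀ I → C I → let open ArcConsistency I in
  ∀ E → EstablishedBy E → (∀ x → Nonempty (E x)) → Solution I

------------------------------------------------------------------------
-- The pattern BTX

module BTX-Definition where

  pattern x = zero
  pattern y = suc zero
  pattern z = suc (suc zero)

  pattern ε = zero
  pattern α = suc zero
  pattern β = suc (suc zero)
  pattern γ = suc (suc (suc zero))
  pattern δ = suc (suc (suc (suc zero)))

  dom : Fin 3 → Subset 5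
  dom x = ⁅ ε ⁆
  dom y = ⁅ α ⁆ ∪ ⁅ β ⁆
  dom z = ⁅ γ ⁆ ∪ ⁅ δ ⁆

  dom-nonempty : ∀ v → Nonempty (dom v)
  dom-nonempty x = ε , from-yes (ε ∈? dom x)
  dom-nonempty y = α , from-yes (α ∈? dom y)
  dom-nonempty z = γ , from-yes (γ ∈? dom z)

  -- The domains are disjoint, so edges may be given between values.
  edge : Fin 5 → Fin 5 → Maybe Bool
  edge α γ = just false
  edge γ α = just false
  edge ε δ = just false
  edge δ ε = just false
  edge α δ = just true
  edge δ α = just true
  edge β γ = just true
  edge γ β = just true
  edge α ε = just true
  edge ε α = just true
  edge ε γ = just true
  edge γ ε = just true
  edge _ _ = nothing

  edge-sym : ∀ a b → edge a b ≡ edge b a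
  edge-sym = from-yes (all? λ a → all? λ b →
    Maybe.≡-dec Bool._≟_ (edge a b) (edge b a))

  edge-same-var : ∀ v a → a ∈ dom v → ∀ b → b ∈ dom v → edge a b ≡ nothing
  edge-same-var = from-yes (all? λ v → all? λ a → (a ∈? dom v) →-dec
    all? λ b → (b ∈? dom v) →-dec Maybe.≡-dec Bool._≟_ (edge a b) nothing)

  data _<X_ : Rel (Fin 3) 0ℓ where
    y<x : y <X x
    y<z : y <X z

  data _<D_ : Rel (Fin 5) 0ℓ where
    β<α : β <D α

  <X-strict : IsStrictPartialOrder _≡_ _<X_
  <X-strict = record
    { isEquivalence = isEquivalence
    ; irrefl        = λ { refl () }
    ; trans         = λ { y<x () ; y<z () }
    ; <-resp-≈      = resp₂ _<X_
    }

  <D-strict : IsStrictPartialOrder _≡_ _<D_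
  <D-strict = record
    { isEquivalence = isEquivalence
    ; irrefl        = λ { refl () }
    ; trans         = λ { β<α () }
    ; <-resp-≈      = resp₂ _<D_
    }

  BTX : Pattern
  BTX = record
    { unordered = record
      { #vars        = 3
      ; #vals        = 5
      ; dom          = dom
      ; dom-nonempty = dom-nonempty
      ; cpt          = λ p q → edge (val p) (val q)
      ; cpt-sym      = λ p q → edge-sym (val p) (val q)
      ; cpt-same-var = λ { (point v a a∈) (point .v b b∈) refl →
          edge-same-var v a (recompute (a ∈? dom v) a∈)
                          b (recompute (b ∈? dom v) b∈) }
      }
    ; _<X_      = _<X_
    ; _<D_      = _<D_
    ; <X-strict = <X-strict
    ; <D-strict = <D-strict
    }

open BTX-Definition public using (BTX)

{-# OPTIONS --safe #-}

-- Process the variables in increasing order, giving the current variable y the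
-- largest value α of its current domain and then keeping in every later domain
-- only the values compatible with α.  Arc consistency survives the restriction:
-- let a value ε of x be kept and let z be another later variable.  Take a
-- support δ of α and a support γ of ε, both at z.  If neither is compatible
-- with both α and ε, then a support β of γ at y differs from α, so β < α by
-- maximality, and the values found form an occurrence of BTX.
--
-- An instance avoids BTX only in the sense that not every pair of orders admits
-- a homomorphism, which does not produce a bad pair of orders constructively.
-- Since solvability and the existence of an occurrence for given orders are
-- both decidable, it is enough to find an occurrence for each pair of orders
-- when there is no solution.
module Submission where

open import Defs

open import Data.Bool using (Bool; true; false)
import Data.Bool.Properties as Bool
open import Data.Fin using (Fin; _≟_; finToFun; funToFin)
open import Data.Fin.Induction using (Acc; acc; spo-noetherian)
open import Data.Fin.Properties using (all?; any?; finToFun-funToFin)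
open import Data.Fin.Subset using (Nonempty; ⁅_⁆) renaming (_∈_ to _∈ₛ_)
open import Data.Fin.Subset.Properties
  using (_∈?_; x∈⁅y⁆⇒x≡y; x∈p∪q⁻; p─q⊆p)
open import Data.List using (List; []; _∷_; allFin)
open import Data.List.Membership.Propositional using (_∈_)
open import Data.List.Membership.Propositional.Properties using (∈-allFin)
open import Data.List.Relation.Binary.Permutation.Propositional using (↭-sym; ↭⇒↭ₛ)
open import Data.List.Relation.Binary.Permutation.Propositional.Properties
  using (∈-resp-↭)
open import Data.List.Relation.Binary.Permutation.Setoid.Properties
  using (Unique-resp-↭)
import Data.List.Relation.Unary.All as All
open import Data.List.Relation.Unary.AllPairs as AllPairs using (AllPairs; []; _∷_)
open import Data.List.Relation.Unary.Any using (here; there)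
open import Data.List.Relation.Unary.Sorted.TotalOrder.Properties
  using (Sorted⇒AllPairs)
open import Data.List.Relation.Unary.Unique.Propositional.Properties using (allFin⁺)
import Data.List.Sort as Sort
open import Data.Maybe using (just; nothing)
import Data.Maybe.Properties as Maybe
open import Data.Nat using (ℕ)
open import Data.Product using (Σ-syntax; ∃; ∃-syntax; _×_; _,_; proj₁; proj₂)
open import Data.Sum using (inj₁; inj₂)
open import Data.Vec.Functional using (updateAt)
open import Data.Vec.Functional.Properties using (updateAt-updates; updateAt-minimal)
open import Function using (_∘_; const)
open import Level using (0ℓ)
open import Relation.Binary.Bundles using (DecTotalOrder)
open import Relation.Binary.Construct.Closure.ReflexiveTransitive as Star using (Star; _◅_)
import Relation.Binary.Construct.StrictToNonStrict as StrictToNonStrict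
open import Relation.Binary.Core using (Rel)
open import Relation.Binary.Definitions using (tri<; tri≈; tri>)
open import Relation.Binary.PropositionalEquality
  using (_≡_; _≢_; refl; sym; trans; subst; subst₂; setoid; ≢-sym)
open import Relation.Binary.Structures using (IsStrictTotalOrder)
open import Relation.Nullary using (¬_; Dec; yes; no; contradiction)
open import Relation.Nullary.Decidable
  using (map′; recompute; ¬?; _×-dec_; _→-dec_)
open import Relation.Unary using (Pred; Decidable)

-- Maximal elements and increasing enumerations in finite total orders

module _ {n : ℕ} {_<_ : Rel (Fin n) 0ℓ} (<-total : IsStrictTotalOrder _≡_ _<_) where

  open IsStrictTotalOrder <-total using (isStrictPartialOrder; _<?_)

  -- Passing to a larger witness as long as one exists must stop, because a strict order on a finite
  -- set is Noetherian.
  ∃-maximal : {P : Pred (Fin n) 0ℓ} → Decidable P → ∃ P →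
              ∃[ m ] P m × (∀ {b} → P b → ¬ m < b)
  ∃-maximal {P} P? (a , Pa) = go a Pa (spo-noetherian isStrictPartialOrder a)
    where
    go : ∀ a → P a → Acc (λ b c → c < b) a → ∃[ m ] P m × (∀ {b} → P b → ¬ m < b)
    go a Pa (acc rs) with any? (λ b → P? b ×-dec (a <? b))
    ... | yes (b , Pb , a<b) = go b Pb (rs a<b)
    ... | no ¬larger         = a , Pa , λ Pb a<b → ¬larger (_ , Pb , a<b)

  -- Sorting yields only `≤` between entries; it becomes strict because a permutation of `allFin n`
  -- has no repetitions.
  increasing-enumeration : ∃[ vs ] AllPairs _<_ vs × (∀ v → v ∈ vs)
  increasing-enumeration =
      sort (allFin n)
    , AllPairs.zipWith ≤∧≢⇒<
        ( Sorted⇒AllPairs (DecTotalOrder.totalOrder ≤-order) (sort-↗ (allFin n))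
        , Unique-resp-↭ (setoid (Fin n)) (↭⇒↭ₛ (↭-sym (sort-↭ (allFin n)))) (allFin⁺ n))
    , λ v → ∈-resp-↭ (↭-sym (sort-↭ (allFin n))) (∈-allFin v)
    where
    open StrictToNonStrict _≡_ _<_ using (_≤_; isDecTotalOrder)

    ≤-order : DecTotalOrder 0ℓ 0ℓ 0ℓ
    ≤-order = record { isDecTotalOrder = isDecTotalOrder <-total }

    open Sort ≤-order using (sort; sort-↭; sort-↗)

    ≤∧≢⇒< : ∀ {u v} → u ≤ v × u ≢ v → u < v
    ≤∧≢⇒< (inj₁ u<v , _)   = u<v
    ≤∧≢⇒< (inj₂ u≡v , u≢v) = contradiction u≡v u≢v

-- The functions are coded by the elements of one finite set, which is searched. Decoding returns a
-- function only up to pointwise equality, so `P` has to respect that equality.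
∃-function? : ∀ {n d} {P : Pred (Fin n → Fin d) 0ℓ} →
              (∀ {f g} → (∀ i → f i ≡ g i) → P f → P g) →
              Decidable P → Dec (∃ P)
∃-function? resp P? = map′
  (λ (k , Pk) → finToFun k , Pk)
  (λ (f , Pf) → funToFin f , resp (sym ∘ finToFun-funToFin f) Pf)
  (any? (P? ∘ finToFun))

-- Signed edges of an instance and decidability of solvability

module _ (I : Instance) where

  open Instance I

  -- `Edge true` unfolds to `R`, so the facts about edges of either sign apply to `R` directly.
  Edge : Bool → (u v : Fin #vars) → Rel (Fin #vals) 0ℓ
  Edge c u v a b = Σ[ a∈ ∈ a ∈ₛ dom u ] Σ[ b∈ ∈ b ∈ₛ dom v ]
                   cpt (point u a a∈) (point v b b∈) ≡ just c

  edge? : ∀ c u v a b → Dec (Edge c u v a b)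
  edge? c u v a b with a ∈? dom u | b ∈? dom v
  ... | no a∉  | _      = no λ (a∈ , _) → a∉ a∈
  ... | yes _  | no b∉  = no λ (_ , b∈ , _) → b∉ b∈
  ... | yes a∈ | yes b∈ = map′ (λ eq → a∈ , b∈ , eq) (λ (_ , _ , eq) → eq)
    (Maybe.≡-dec Bool._≟_ (cpt (point u a a∈) (point v b b∈)) (just c))

  edge-sym : ∀ {c u v a b} → Edge c u v a b → Edge c v u b a
  edge-sym (a∈ , b∈ , eq) = b∈ , a∈ , trans (cpt-sym _ _) eq

  edge⇒≢ : ∀ {c u v a b} → Edge c u v a b → u ≢ v
  edge⇒≢ (_ , _ , eq) u≡v with () ← trans (sym eq) (cpt-same-var _ _ u≡v)

  negative : ∀ {u v a b} → u ≢ v → a ∈ₛ dom u → b ∈ₛ dom v →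
             ¬ R u v a b → Edge false u v a b
  negative {u} {v} {a} {b} u≢v a∈ b∈ ¬R
    with cpt (point u a a∈) (point v b b∈)
       | cpt-total (point u a a∈) (point v b b∈) u≢v
  ... | just true  | _  = contradiction (a∈ , b∈ , refl) ¬R
  ... | just false | _  = a∈ , b∈ , refl
  ... | nothing    | ()

  solution? : Dec (Solution I)
  solution? = map′
    (λ (s , s∈ , c) → record { s = s ; s∈dom = s∈ ; compatible = c })
    (λ S → let open Solution S in s , s∈dom , compatible)
    (∃-function?
      (λ f≗g (f∈ , c) →
          (λ u → subst (_∈ₛ dom u) (f≗g u) (f∈ u))
        , (λ u v u≢v → subst₂ (R u v) (f≗g u) (f≗g v) (c u v u≢v)))
      (λ s → all? (λ u → s u ∈? dom u) ×-dec
             all? (λ u → all? (λ v →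
               ¬? (u ≟ v) →-dec edge? true u v (s u) (s v)))))

  ArcConsistentOn : List (Fin #vars) → (Fin #vars → Pred (Fin #vals) 0ℓ) → Set
  ArcConsistentOn vs E = ∀ {u v} → u ∈ vs → v ∈ vs → u ≢ v →
                         ∀ {a} → E u a → ∃[ b ] E v b × R u v a b

  -- Occurrences of BTX for fixed orders

  module _ {_<X_ : Rel (Fin #vars) 0ℓ} (<X-total : IsStrictTotalOrder _≡_ _<X_)
           {_<D_ : Rel (Fin #vals) 0ℓ} (<D-total : IsStrictTotalOrder _≡_ _<D_) where

    private
      module X = IsStrictTotalOrder <X-total
      module D = IsStrictTotalOrder <D-total

    -- The image of BTX spelled out as a tuple, over which a finite search is possible. Distinctness
    -- of the three variables is implied, since edges join points of distinct variables.
    OccursAt : (x y z : Fin #vars) (ε α β γ δ : Fin #vals) → Set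
    OccursAt x y z ε α β γ δ =
      y <X x × y <X z × β <D α ×
      Edge false y z α γ × Edge false x z ε δ ×
      Edge true y z α δ × Edge true y z β γ × Edge true y x α ε × Edge true x z ε γ

    Occurrence : Set
    Occurrence = ∃[ x ] ∃[ y ] ∃[ z ] ∃[ ε ] ∃[ α ] ∃[ β ] ∃[ γ ] ∃[ δ ]
                 OccursAt x y z ε α β γ δ

    occurrence? : Dec Occurrence
    occurrence? =
      any? λ x → any? λ y → any? λ z →
      any? λ ε → any? λ α → any? λ β → any? λ γ → any? λ δ →
      (y X.<? x) ×-dec (y X.<? z) ×-dec (β D.<? α) ×-dec
      edge? false y z α γ ×-dec edge? false x z ε δ ×-dec
      edge? true y z α δ ×-dec edge? true y z β γ ×-dec
      edge? true y x α ε ×-dec edge? true x z ε γ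

    occurrence⇒homomorphism : Occurrence → Homomorphism BTX (equip I <X-total <D-total)
    occurrence⇒homomorphism
      (x , y , z , ε , α , β , γ , δ , y<x , y<z , β<α , αγ , εδ , αδ , βγ , αε , εγ) = record
      { f               = place
      ; f-cpt           = λ p q c → place-cpt (vertex p) (vertex q)
      ; f-var           = f-var
      ; f-var-def       = λ _ → refl
      ; f-var-injective = f-var-injective _ _
      ; f-var-mono      = λ where
          _ _ B.y<x → y<x
          _ _ B.y<z → y<z
      ; f-val-mono      = λ { (point _ _ _) (point _ _ _) _ B.β<α → β<α }
      }
      where
      module B = BTX-Definition

      -- Matching on this family fixes the variable and the value of a point of BTX together,
      -- leaving only the five actual points.
      data Vertex : Fin 3 → Fin 5 → Set where
        xε : Vertex B.x B.ε
        yα : Vertex B.y B.α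
        yβ : Vertex B.y B.β
        zγ : Vertex B.z B.γ
        zδ : Vertex B.z B.δ

      ∈dom⇒vertex : ∀ v {a} → a ∈ₛ B.dom v → Vertex v a
      ∈dom⇒vertex B.x a∈ with refl ← x∈⁅y⁆⇒x≡y B.ε a∈ = xε
      ∈dom⇒vertex B.y a∈ with x∈p∪q⁻ ⁅ B.α ⁆ ⁅ B.β ⁆ a∈
      ... | inj₁ a∈α with refl ← x∈⁅y⁆⇒x≡y B.α a∈α = yα
      ... | inj₂ a∈β with refl ← x∈⁅y⁆⇒x≡y B.β a∈β = yβ
      ∈dom⇒vertex B.z a∈ with x∈p∪q⁻ ⁅ B.γ ⁆ ⁅ B.δ ⁆ a∈
      ... | inj₁ a∈γ with refl ← x∈⁅y⁆⇒x≡y B.γ a∈γ = zγ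
      ... | inj₂ a∈δ with refl ← x∈⁅y⁆⇒x≡y B.δ a∈δ = zδ

      vertex : (p : PointOf B.dom) → Vertex (var p) (val p)
      -- The membership proof stored in a point is irrelevant; deciding membership again recovers
      -- one that can be analysed.
      vertex (point v a a∈) = ∈dom⇒vertex v (recompute (a ∈? B.dom v) a∈)

      f-var : Fin 3 → Fin #vars
      f-var B.x = x
      f-var B.y = y
      f-var B.z = z

      f-val : Fin 5 → Fin #vals
      f-val B.ε = ε
      f-val B.α = α
      f-val B.β = β
      f-val B.γ = γ
      f-val B.δ = δ

      f-val∈dom : ∀ {v a} → Vertex v a → f-val a ∈ₛ dom (f-var v)
      f-val∈dom xε = proj₁ εγ
      f-val∈dom yα = proj₁ αγ
      f-val∈dom yβ = proj₁ βγ
      f-val∈dom zγ = proj₁ (proj₂ εγ)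
      f-val∈dom zδ = proj₁ (proj₂ εδ)

      place : PointOf B.dom → Point
      place p = point (f-var (var p)) (f-val (val p)) (f-val∈dom (vertex p))

      -- Points with the same variable and value are definitionally equal, so the membership proofs
      -- inside the edge may be exchanged for any others.
      cpt-of : ∀ {c u v a b} .{a∈ : a ∈ₛ dom u} .{b∈ : b ∈ₛ dom v} →
               Edge c u v a b → cpt (point u a a∈) (point v b b∈) ≡ just c
      cpt-of (_ , _ , eq) = eq

      place-cpt : ∀ {u v a b c} .{a∈ : f-val a ∈ₛ dom (f-var u)}
                  .{b∈ : f-val b ∈ₛ dom (f-var v)} → Vertex u a → Vertex v b →
                  B.edge a b ≡ just c →
                  cpt (point (f-var u) (f-val a) a∈) (point (f-var v) (f-val b) b∈) ≡ just c
      place-cpt xε yα refl = cpt-of (edge-sym αε)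
      place-cpt xε zγ refl = cpt-of εγ
      place-cpt xε zδ refl = cpt-of εδ
      place-cpt yα xε refl = cpt-of αε
      place-cpt yα zγ refl = cpt-of αγ
      place-cpt yα zδ refl = cpt-of αδ
      place-cpt yβ zγ refl = cpt-of βγ
      place-cpt zγ xε refl = cpt-of (edge-sym εγ)
      place-cpt zγ yα refl = cpt-of (edge-sym αγ)
      place-cpt zγ yβ refl = cpt-of (edge-sym βγ)
      place-cpt zδ xε refl = cpt-of (edge-sym εδ)
      place-cpt zδ yα refl = cpt-of (edge-sym αδ)
      -- The remaining pairs have undefined compatibility in BTX.
      place-cpt xε xε ()
      place-cpt xε yβ ()
      place-cpt yα yα ()
      place-cpt yα yβ ()
      place-cpt yβ xε ()
      place-cpt yβ yα ()
      place-cpt yβ yβ ()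
      place-cpt yβ zδ ()
      place-cpt zγ zγ ()
      place-cpt zγ zδ ()
      place-cpt zδ yβ ()
      place-cpt zδ zγ ()
      place-cpt zδ zδ ()

      f-var-injective : ∀ u v → f-var u ≡ f-var v → u ≡ v
      f-var-injective B.x B.x _  = refl
      f-var-injective B.x B.y eq = contradiction (sym eq) (edge⇒≢ αε)
      f-var-injective B.x B.z eq = contradiction eq (edge⇒≢ εγ)
      f-var-injective B.y B.x eq = contradiction eq (edge⇒≢ αε)
      f-var-injective B.y B.y _  = refl
      f-var-injective B.y B.z eq = contradiction eq (edge⇒≢ αγ)
      f-var-injective B.z B.x eq = contradiction (sym eq) (edge⇒≢ εγ)
      f-var-injective B.z B.y eq = contradiction (sym eq) (edge⇒≢ αγ)
      f-var-injective B.z B.z _  = refl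

    -- Greedy construction of a solution without backtracking

    module _ (¬occurrence : ¬ Occurrence) where

      -- The values s₀ are used only for variables outside vs.
      solve : (s₀ : Fin #vars → Fin #vals) →
              ∀ vs → AllPairs _<X_ vs →
              (E : Fin #vars → Pred (Fin #vals) 0ℓ) → (∀ v → Decidable (E v)) →
              (∀ {v} → v ∈ vs → ∃ (E v)) → ArcConsistentOn vs E →
              Σ[ s ∈ (Fin #vars → Fin #vals) ]
                (∀ {v} → v ∈ vs → E v (s v)) ×
                (∀ {u v} → u ∈ vs → v ∈ vs → u ≢ v → R u v (s u) (s v))
      solve s₀ [] _ _ _ _ _ = s₀ , (λ ()) , (λ ())
      solve s₀ (y ∷ vs) (y<vs ∷ sorted) E E? nonempty ac
        with α , Eα , α-max ← ∃-maximal <D-total (E? y) (nonempty (here refl))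
        = s′ , s′∈E , s′-compatible
        where
        E′ : Fin #vars → Pred (Fin #vals) 0ℓ
        E′ v b = E v b × R y v α b

        y≢ : ∀ {v} → v ∈ vs → y ≢ v
        y≢ v∈ y≡v = X.irrefl y≡v (All.lookup y<vs v∈)

        nonempty′ : ∀ {v} → v ∈ vs → ∃ (E′ v)
        -- The support of `α` at `v` is itself a value that survives the restriction.
        nonempty′ v∈ = ac (here refl) (there v∈) (y≢ v∈) Eα

        below-α : ∀ {β} → E y β → α ≢ β → β <D α
        below-α {β} Eβ α≢β with D.compare α β
        ... | tri< α<β _ _ = contradiction α<β (α-max Eβ)
        ... | tri≈ _ α≡β _ = contradiction α≡β α≢β
        ... | tri> _ _ β<α = β<α

        ac′ : ArcConsistentOn vs E′
        ac′ {x} {z} x∈ z∈ x≢z {ε} (Eε , αε)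
          with δ , Eδ , αδ ← nonempty′ z∈
          with edge? true x z ε δ
        ... | yes εδ = δ , (Eδ , αδ) , εδ
        ... | no ¬εδ
          with γ , Eγ , εγ ← ac (there x∈) (there z∈) x≢z Eε
          with edge? true y z α γ
        ... | yes αγ = γ , (Eγ , αγ) , εγ
        ... | no ¬αγ
          with β , Eβ , γβ ← ac (there z∈) (here refl) (≢-sym (y≢ z∈)) Eγ
          = contradiction
              ( x , y , z , ε , α , β , γ , δ
              , All.lookup y<vs x∈ , All.lookup y<vs z∈
              -- If `β` were `α`, the edge `γβ` would make `α` and `γ` compatible.
              , below-α Eβ (λ { refl → ¬αγ (edge-sym γβ) })
              , negative (y≢ z∈) (proj₁ αδ) (proj₁ γβ) ¬αγ
              , negative x≢z (proj₁ εγ) (proj₁ (proj₂ αδ)) ¬εδ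
              , αδ , edge-sym γβ , αε , εγ)
              ¬occurrence

        rest = solve s₀ vs sorted E′ (λ v b → E? v b ×-dec edge? true y v α b) nonempty′ ac′

        s            = proj₁ rest
        s∈E′         = proj₁ (proj₂ rest)
        s-compatible = proj₂ (proj₂ rest)

        s′ : Fin #vars → Fin #vals
        -- Since `y` is smaller than all of `vs`, it is not among them, and the overwriting leaves
        -- their values intact.
        s′ = updateAt s y (const α)

        s′y≡α : s′ y ≡ α
        s′y≡α = updateAt-updates y s

        s′≡s : ∀ {v} → v ∈ vs → s′ v ≡ s v
        s′≡s {v} v∈ = updateAt-minimal v y s (≢-sym (y≢ v∈))

        s′∈E : ∀ {v} → v ∈ y ∷ vs → E v (s′ v)
        s′∈E (here refl) = subst (E y) (sym s′y≡α) Eα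
        s′∈E (there v∈)  = subst (E _) (sym (s′≡s v∈)) (proj₁ (s∈E′ v∈))

        y-compatible : ∀ {v} → v ∈ vs → R y v (s′ y) (s′ v)
        y-compatible v∈ =
          subst₂ (R y _) (sym s′y≡α) (sym (s′≡s v∈)) (proj₂ (s∈E′ v∈))

        s′-compatible : ∀ {u v} → u ∈ y ∷ vs → v ∈ y ∷ vs → u ≢ v → R u v (s′ u) (s′ v)
        s′-compatible (here refl) (here refl) u≢v = contradiction refl u≢v
        s′-compatible (here refl) (there v∈)  _   = y-compatible v∈
        s′-compatible (there u∈)  (here refl) _   = edge-sym (y-compatible u∈)
        s′-compatible (there u∈)  (there v∈)  u≢v =
          subst₂ (R _ _) (sym (s′≡s u∈)) (sym (s′≡s v∈)) (s-compatible u∈ v∈ u≢v)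

  -- From established arc consistency to a solution

  open ArcConsistency I

  ⟶-⊆ : ∀ {E F} → E ⟶ F → ∀ v {a} → a ∈ₛ F v → a ∈ₛ E v
  ⟶-⊆ {E} (remove p _ _) v {a} a∈ with var p ≟ v
  ... | yes refl = p─q⊆p _ _ (subst (a ∈ₛ_) (updateAt-updates v E) a∈)
  ... | no p≢v   = subst (a ∈ₛ_) (updateAt-minimal v (var p) E (≢-sym p≢v)) a∈

  -- Solutions and `R` refer to the original domains, so values found in the reduced ones must be
  -- carried back.
  ⟶*-⊆ : ∀ {E F} → Star _⟶_ E F → ∀ v {a} → a ∈ₛ F v → a ∈ₛ E v
  ⟶*-⊆ Star.ε     v = λ a∈ → a∈
  ⟶*-⊆ (E⟶ ◅ ⟶*F) v = ⟶-⊆ E⟶ v ∘ ⟶*-⊆ ⟶*F v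

  established⇒arcConsistentOn : ∀ {E} → EstablishedBy E →
    ∀ vs → ArcConsistentOn vs (λ v a → a ∈ₛ E v)
  established⇒arcConsistentOn {E} (dom⟶*E , ac) _ {u} {v} _ _ u≢v {a} a∈E
    with a∈ ← ⟶*-⊆ dom⟶*E u a∈E
    with point .v b _ , refl , b∈E , eq ← ac (point u a a∈) a∈E v (≢-sym u≢v)
    = b , b∈E , a∈ , ⟶*-⊆ dom⟶*E v b∈E , eq

  established⇒solution :
    {_<X_ : Rel (Fin #vars) 0ℓ} (<X-total : IsStrictTotalOrder _≡_ _<X_)
    {_<D_ : Rel (Fin #vals) 0ℓ} (<D-total : IsStrictTotalOrder _≡_ _<D_) →
    ¬ Occurrence <X-total <D-total →
    ∀ {E} → EstablishedBy E → (∀ v → Nonempty (E v)) → Solution I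
  established⇒solution <X-total <D-total ¬occurrence {E} established nonempty =
    let vs , sorted , v∈ = increasing-enumeration <X-total
        s , s∈E , compatible =
          -- `proj₁ ∘ nonempty` only serves as the initial assignment: `vs` lists every variable, so
          -- each of its values gets overwritten.
          solve <X-total <D-total ¬occurrence (proj₁ ∘ nonempty) vs sorted
            (λ v a → a ∈ₛ E v) (λ v a → a ∈? E v) (λ {v} _ → nonempty v)
            (established⇒arcConsistentOn established vs)
    in record
      { s          = s
      ; s∈dom      = λ v → ⟶*-⊆ (proj₁ established) v (s∈E (v∈ v))
      ; compatible = λ u v → compatible (v∈ u) (v∈ v)
      }

theorem3p2 : ACDecides (CSP-SP BTX)
theorem3p2 I ¬occurs E established nonempty with solution? I
... | yes solution = solution
... | no ¬solution = contradiction occurs ¬occurs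
  where
  occurs : BTX OccursIn I
  occurs _ <X-total _ <D-total with occurrence? I <X-total <D-total
  ... | yes occurrence = occurrence⇒homomorphism I <X-total <D-total occurrence
  ... | no ¬occurrence = contradiction
    (established⇒solution I <X-total <D-total ¬occurrence established nonempty) ¬solution
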